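{- Let $k\ge 1$ and let $T=P_{2k}$ be the path on $2k$ vertices labelled $v_1,v_2,\dots,v_{2k}$. Let $X$ and $Y$ be two different trees with the same number of vertices, and let $s\in V(X)$ and $t\in V(Y)$ be such that $p_x-p_s=p_y-p_t$. Then all trees in the set $STW(T,X,Y)$ have the same terminal Wiener index.
   Context: A pendent vertex (leaf) of a tree is a vertex of degree $1$. The terminal Wiener index $TW$ of a tree is the sum of the distances between all (unordered) pairs of its pendent vertices. $p_x$ and $p_y$ denote the numbers of pendent vertices of $X$ and $Y$, respectively. $p_s=1$ if $s$ is a pendent vertex of $X$, and $p_s=0$ otherwise; $p_t=1$ if $t$ is a pendent vertex of $Y$, and $p_t=0$ otherwise. The set $STW(T,X,Y)$ consists of the trees constructed as follows. Each element is obtained from a copy of $T$, $k$ copies of $X$ and $k$ copies of $Y$: copies of $X$ are attached via their vertices $s$ (by identifying $s$ with the path vertex) to $k$ among the vertices $v_1,v_2,\dots,v_{2k}$ of $T$, one copy per vertex, and copies of $Y$ are attached via their vertices $t$ (by identifying $t$ with the path vertex) to the remaining $k$ vertices among $v_1,v_2,\dots,v_{2k}$, one copy per vertex. -}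

module Defs where

open import Data.Bool.Base using (if_then_else_)
open import Data.Fin.Base using (Fin; zero; suc; toℕ; fromℕ; inject₁; remQuot)
open import Data.Fin.Permutation using (Permutation; _⟨$⟩ʳ_)
open import Data.Fin.Properties using (any?; _≟_; _<?_)
open import Data.Fin.Subset using (Subset; ∣_∣)
open import Data.Nat.Base using (ℕ; zero; suc; _+_; _*_; _<_; _≤_; z≤n; s≤s)
import Data.Nat.Properties as ℕ
open import Data.Product.Base using (Σ; ∃; ∃-syntax; _×_; _,_; proj₁; proj₂)
open import Data.Sum.Base using (_⊎_; inj₁; inj₂; swap)
open import Data.Vec.Base using (lookup)
open import Function.Base using (_∘_)
open import Function.Bundles using (_⇔_)
open import Function.Definitions using (Injective)
open import Relation.Binary.Core using (Rel)
open import Relation.Binary.Definitions using (Decidable; Symmetric; Irreflexive)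
open import Relation.Binary.PropositionalEquality using (_≡_; refl)
open import Relation.Nullary.Decidable using (Dec; yes; no; does; map′; _×-dec_; _⊎-dec_)
open import Relation.Nullary.Negation using (¬_; contradiction)
open import Level using (0ℓ)

open import Algebra.Properties.CommutativeMonoid.Sum ℕ.+-0-commutativeMonoid using (sum-syntax)

record Graph (n : ℕ) : Set₁ where
  field
    Adj    : Rel (Fin n) 0ℓ
    adj?   : Decidable Adj
    symm   : Symmetric Adj
    irrefl : Irreflexive _≡_ Adj

open Graph public

infix 4 _≅_

_≅_ : ∀ {m n} → Graph m → Graph n → Set
_≅_ {m} {n} G H =
  Σ (Permutation m n) λ π → ∀ u v → Adj G u v ⇔ Adj H (π ⟨$⟩ʳ u) (π ⟨$⟩ʳ v)

data Walk {n} (G : Graph n) : ℕ → Fin n → Fin n → Set where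
  []  : ∀ {u} → Walk G 0 u u
  _∷_ : ∀ {l u v w} → Adj G u v → Walk G l v w → Walk G (suc l) u w

-- A cycle of length 3 + m visits the distinct vertices c 0, …, c (2 + m) in
-- this order and then returns to c 0.
IsCycle : ∀ {n} → Graph n → ∀ {m} → (Fin (3 + m) → Fin n) → Set
IsCycle G {m} c =
  Injective _≡_ _≡_ c ×
  (∀ (i : Fin (2 + m)) → Adj G (c (inject₁ i)) (c (suc i))) ×
  Adj G (c (fromℕ (2 + m))) (c zero)

record IsTree {n} (G : Graph n) : Set where
  field
    nonempty  : 0 < n
    connected : ∀ u v → ∃[ l ] Walk G l u v
    acyclic   : ∀ {m} (c : Fin (3 + m) → Fin n) → ¬ IsCycle G c

record Tree (n : ℕ) : Set₁ where
  field
    graph  : Graph n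
    isTree : IsTree graph

  open IsTree isTree public

open Tree public using (graph)

IsDistance : ∀ {n} → Graph n → Fin n → Fin n → ℕ → Set
IsDistance G u v d = Walk G d u v × (∀ l → Walk G l u v → d ≤ l)

walk? : ∀ {n} (G : Graph n) l u v → Dec (Walk G l u v)
walk? G zero    u v = map′ (λ { refl → [] }) (λ { [] → refl }) (u ≟ v)
walk? G (suc l) u w =
  map′ (λ (_ , e , p) → e ∷ p) (λ { (e ∷ p) → _ , e , p })
       (any? λ v → adj? G u v ×-dec walk? G l v w)

least : ∀ {P : ℕ → Set} → (∀ l → Dec (P l)) → ∀ m → P m →
        ∃[ d ] P d × (∀ l → P l → d ≤ l)
least P? zero    p = 0 , p , λ _ _ → z≤n
least {P} P? (suc m) p with P? 0
... | yes p₀ = 0 , p₀ , λ _ _ → z≤n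
... | no ¬p₀ with least (P? ∘ suc) m p
...   | d , q , min = suc d , q , λ { zero    r → contradiction r ¬p₀
                                    ; (suc l) r → s≤s (min l r) }

distance : ∀ {n} (T : Tree n) u v → ∃ (IsDistance (graph T) u v)
distance T u v with Tree.connected T u v
... | l , p = least (λ d → walk? (graph T) d u v) l p

dist : ∀ {n} → Tree n → Fin n → Fin n → ℕ
dist T u v = proj₁ (distance T u v)

⟦_⟧ : ∀ {P : Set} → Dec P → ℕ
⟦ P? ⟧ = if does P? then 1 else 0

degree : ∀ {n} → Graph n → Fin n → ℕ
degree {n} G u = ∑[ v < n ] ⟦ adj? G u v ⟧

Pendent : ∀ {n} → Graph n → Fin n → Set
Pendent G v = degree G v ≡ 1

pendent? : ∀ {n} (G : Graph n) v → Dec (Pendent G v)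
pendent? G v = degree G v ℕ.≟ 1

#pendent : ∀ {n} → Graph n → ℕ
#pendent {n} G = ∑[ v < n ] ⟦ pendent? G v ⟧

-- Each unordered pair {u , v} is counted once, with u < v.
TW : ∀ {n} → Tree n → ℕ
TW {n} T = ∑[ u < n ] ∑[ v < n ]
  (⟦ u <? v ×-dec pendent? (graph T) u ×-dec pendent? (graph T) v ⟧ * dist T u v)

-- The vertex v_{i+1} of the path is the element i of Fin m.
path : ∀ m → Graph m
path m = record
  { Adj    = λ i j → suc (toℕ i) ≡ toℕ j ⊎ suc (toℕ j) ≡ toℕ i
  ; adj?   = λ i j → (suc (toℕ i) ℕ.≟ toℕ j) ⊎-dec (suc (toℕ j) ℕ.≟ toℕ i)
  ; symm   = swap
  ; irrefl = λ { refl (inj₁ e) → ℕ.1+n≢n e ; refl (inj₂ e) → ℕ.1+n≢n e }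
  }

RootedGraph : ℕ → Set₁
RootedGraph n = Graph n × Fin n

-- Attach to every vertex i of T its own copy of the graph of F i, identifying
-- i with the root of that copy.  The vertex u of the i-th copy is
-- combine i u : Fin (m * n); the vertex i of T is represented by the root of
-- the i-th copy.
attach : ∀ {m n} → Graph m → (Fin m → RootedGraph n) → Graph (m * n)
attach {m} {n} T F = record
  { Adj    = λ a b → E (remQuot n a) (remQuot n b)
  ; adj?   = λ a b → E? (remQuot n a) (remQuot n b)
  ; symm   = λ {a} {b} → E-sym (remQuot n a) (remQuot n b)
  ; irrefl = λ { {a} refl → E-irrefl (remQuot n a) }
  }
  where
  root : Fin m → Fin n
  root = proj₂ ∘ F

  E : Rel (Fin m × Fin n) 0ℓ
  E (i , u) (j , v) =
    (i ≡ j × Adj (proj₁ (F i)) u v) ⊎ (Adj T i j × u ≡ root i × v ≡ root j)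

  E? : Decidable E
  E? (i , u) (j , v) =
    (i ≟ j ×-dec adj? (proj₁ (F i)) u v) ⊎-dec
    (adj? T i j ×-dec u ≟ root i ×-dec v ≟ root j)

  E-sym : ∀ a b → E a b → E b a
  E-sym (i , _) _ (inj₁ (refl , e))  = inj₁ (refl , symm (proj₁ (F i)) e)
  E-sym _ _       (inj₂ (e , p , q)) = inj₂ (symm T e , q , p)

  E-irrefl : ∀ a → ¬ E a a
  E-irrefl (i , _) (inj₁ (_ , e)) = irrefl (proj₁ (F i)) refl e
  E-irrefl _       (inj₂ (e , _)) = irrefl T refl e

-- A is the set of the k vertices of T to which copies of (X , s) are attached;
-- the k vertices outside A receive copies of (Y , t).  Members are taken up to
-- isomorphism.
STW : ∀ k {n} → Graph (2 * k) → RootedGraph n → RootedGraph n →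
      ∀ {N} → Tree N → Set
STW k T Xs Yt Z =
  Σ (Subset (2 * k)) λ A →
    ∣ A ∣ ≡ k × graph Z ≅ attach T (λ i → if lookup A i then Xs else Yt)

{-# OPTIONS --safe #-}

-- Since k ≥ 1 and n ≥ 2, a root of a copy has degree at least 2 in the attached
-- tree, so the pendent vertices are those of the copies other than the roots,
-- and every copy has the same number p of them.  A pair of pendent vertices
-- within copy i contributes to a quantity W i of that copy alone; pairs in
-- distinct copies i and j together contribute p D i + p² d(i,j) + p D j, where
-- D i is the sum of the distances from the root to the pendent vertices of
-- copy i.  Hence only the totals of W and D over all copies matter, and these
-- depend only on the number of copies of X and of Y.

module Submission where

open import Defs
open import Data.Bool.Base using (Bool; true; false; if_then_else_)
open import Data.Fin.Base
  using (Fin; zero; suc; _<_; combine; quotRem; remQuot; punchIn; _↑ˡ_; _↑ʳ_)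
open import Data.Fin.Permutation as Perm using (_⟨$⟩ʳ_; _⟨$⟩ˡ_)
open import Data.Fin.Properties
  using (_≟_; _<?_; <-cmp; remQuot-combine; combine-remQuot; punchInᵢ≢i)
open import Data.Fin.Subset using (Subset; ∣_∣; ∁)
open import Data.Fin.Subset.Properties using (∣∁p∣≡n∸∣p∣)
open import Data.Nat.Base using (ℕ; zero; suc; _+_; _*_; _∸_; _≤_; z≤n; s≤s)
import Data.Nat.Properties as ℕ
open import Data.Nat.Tactic.RingSolver using (solve-∀)
open import Data.Product.Base using (∃; ∃-syntax; _×_; _,_; proj₁; proj₂; swap)
open import Data.Sum.Base using (inj₁; inj₂)
open import Data.Vec.Base using ([]; _∷_; lookup)
open import Function.Base using (_∘_)
open import Function.Bundles using (_⇔_; mk⇔; Equivalence)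
open import Relation.Binary.Definitions using (tri<; tri≈; tri>)
open import Relation.Binary.PropositionalEquality
  using (_≡_; _≢_; refl; sym; trans; cong; cong₂; subst; subst₂; module ≡-Reasoning)
open import Relation.Nullary.Decidable
  using (Dec; yes; no; does; ¬?; _×-dec_; _⊎-dec_; does-⇔; dec-true; dec-false)
open import Relation.Nullary.Negation using (¬_; contradiction)

open import Algebra.Properties.Semiring.Sum ℕ.+-*-semiring
  using (sum-syntax; sum-cong-≗; sum-replicate-zero; sum-permute; ∑-distrib-+; ∑-comm;
         *-distribˡ-sum; *-distribʳ-sum)

open Equivalence using (to; from)

-- Iverson brackets and finite sums

⟦⟧-cong : ∀ {P Q : Set} → P ⇔ Q → (P? : Dec P) (Q? : Dec Q) → ⟦ P? ⟧ ≡ ⟦ Q? ⟧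
⟦⟧-cong P⇔Q P? Q? = cong (λ b → if b then 1 else 0) (does-⇔ P⇔Q P? Q?)

⟦⟧-true : ∀ {P : Set} (P? : Dec P) → P → ⟦ P? ⟧ ≡ 1
⟦⟧-true P? p = cong (λ b → if b then 1 else 0) (dec-true P? p)

⟦⟧-false : ∀ {P : Set} (P? : Dec P) → ¬ P → ⟦ P? ⟧ ≡ 0
⟦⟧-false P? ¬p = cong (λ b → if b then 1 else 0) (dec-false P? ¬p)

⟦⟧-× : ∀ {P Q : Set} (P? : Dec P) (Q? : Dec Q) → ⟦ P? ×-dec Q? ⟧ ≡ ⟦ P? ⟧ * ⟦ Q? ⟧
⟦⟧-× P? Q? with does P?
... | true  = sym (ℕ.+-identityʳ ⟦ Q? ⟧)
... | false = refl

⟦⟧-⊎ : ∀ {P Q : Set} (P? : Dec P) (Q? : Dec Q) → ¬ (P × Q) →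
       ⟦ P? ⊎-dec Q? ⟧ ≡ ⟦ P? ⟧ + ⟦ Q? ⟧
⟦⟧-⊎ P? (yes q) ¬pq = begin
  ⟦ P? ⊎-dec yes q ⟧ ≡⟨ ⟦⟧-true (P? ⊎-dec yes q) (inj₂ q) ⟩
  0 + 1              ≡⟨ cong (_+ 1) (⟦⟧-false P? (λ p → ¬pq (p , q))) ⟨
  ⟦ P? ⟧ + 1         ∎
  where open ≡-Reasoning
⟦⟧-⊎ P? (no ¬q) ¬pq with does P?
... | true  = refl
... | false = refl

term≤∑ : ∀ {n} (f : Fin n → ℕ) i → f i ≤ ∑[ j < n ] f j
term≤∑ f zero    = ℕ.m≤m+n (f zero) _
term≤∑ f (suc i) = ℕ.≤-trans (term≤∑ (f ∘ suc) i) (ℕ.m≤n+m _ (f zero))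

∑-⟦≟⟧ : ∀ {n} i (f : Fin n → ℕ) → ∑[ j < n ] (⟦ i ≟ j ⟧ * f j) ≡ f i
∑-⟦≟⟧ {suc n} zero    f =
  trans (cong₂ _+_ (ℕ.*-identityˡ (f zero)) (sum-replicate-zero n)) (ℕ.+-identityʳ _)
∑-⟦≟⟧ {suc n} (suc i) f = ∑-⟦≟⟧ i (f ∘ suc)

∑-splitAt : ∀ m {n} (f : Fin (m + n) → ℕ) →
            ∑[ a < m + n ] f a ≡ ∑[ i < m ] f (i ↑ˡ n) + ∑[ j < n ] f (m ↑ʳ j)
∑-splitAt zero    f = refl
∑-splitAt (suc m) f =
  trans (cong (f zero +_) (∑-splitAt m (f ∘ suc))) (sym (ℕ.+-assoc (f zero) _ _))

∑-combine : ∀ m {n} (f : Fin (m * n) → ℕ) →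
            ∑[ a < m * n ] f a ≡ ∑[ i < m ] ∑[ u < n ] f (combine i u)
∑-combine zero        f = refl
∑-combine (suc m) {n} f =
  trans (∑-splitAt n f) (cong (∑[ u < n ] f (u ↑ˡ (m * n)) +_) (∑-combine m (f ∘ (n ↑ʳ_))))

∑-cong₂ : ∀ {m n} {f g : Fin m → Fin n → ℕ} → (∀ i j → f i j ≡ g i j) →
          ∑[ i < m ] ∑[ j < n ] f i j ≡ ∑[ i < m ] ∑[ j < n ] g i j
∑-cong₂ f≗g = sum-cong-≗ λ i → sum-cong-≗ (f≗g i)

∑-distrib-+₂ : ∀ {m n} (f g : Fin m → Fin n → ℕ) →
  ∑[ i < m ] ∑[ j < n ] (f i j + g i j) ≡
  ∑[ i < m ] ∑[ j < n ] f i j + ∑[ i < m ] ∑[ j < n ] g i j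
∑-distrib-+₂ {m} {n} f g =
  trans (sum-cong-≗ λ i → ∑-distrib-+ (f i) (g i))
        (∑-distrib-+ (λ i → ∑[ j < n ] f i j) (λ i → ∑[ j < n ] g i j))

∑-* : ∀ {m n} (f : Fin m → ℕ) (g : Fin n → ℕ) →
      ∑[ i < m ] ∑[ j < n ] (f i * g j) ≡ ∑[ i < m ] f i * ∑[ j < n ] g j
∑-* f g = trans (sum-cong-≗ λ i → sym (*-distribˡ-sum (f i) g)) (sym (*-distribʳ-sum _ f))

-- Here the position of the copies is lost: a quantity that depends only on the kind of tree
-- attached at a vertex has a total fixed by the size of `A` and of its complement.
∑-lookup : ∀ {m} (A : Subset m) (g : Bool → ℕ) →
           ∑[ i < m ] g (lookup A i) ≡ ∣ A ∣ * g true + ∣ ∁ A ∣ * g false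
∑-lookup []          g = refl
∑-lookup (true  ∷ A) g =
  trans (cong (g true +_) (∑-lookup A g)) (sym (ℕ.+-assoc (g true) _ _))
∑-lookup (false ∷ A) g =
  trans (cong (g false +_) (∑-lookup A g)) (rearrange (∣ A ∣ * g true) (g false) _)
  where
  rearrange : ∀ a b c → b + (a + c) ≡ a + (b + c)
  rearrange = solve-∀

-- Walks and distances

module _ {n} {G : Graph n} where

  snoc : ∀ {l u v w} → Walk G l u v → Adj G v w → Walk G (suc l) u w
  snoc []      e′ = e′ ∷ []
  snoc (e ∷ p) e′ = e ∷ snoc p e′

  reverse : ∀ {l u v} → Walk G l u v → Walk G l v u
  reverse []      = []
  reverse (e ∷ p) = snoc (reverse p) (symm G e)

  infixr 5 _++_

  _++_ : ∀ {k l u v w} → Walk G k u v → Walk G l v w → Walk G (k + l) u w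
  []      ++ q = q
  (e ∷ p) ++ q = e ∷ (p ++ q)

  mapWalk : ∀ {m} {H : Graph m} (f : Fin n → Fin m) →
            (∀ {u v} → Adj G u v → Adj H (f u) (f v)) →
            ∀ {l u v} → Walk G l u v → Walk H l (f u) (f v)
  mapWalk f f-adj []      = []
  mapWalk f f-adj (e ∷ p) = f-adj e ∷ mapWalk f f-adj p

  -- `φ` drops by at most one along each edge of the walk. If `φ` vanishes at the end, it bounds the
  -- length from below, which certifies a candidate distance without taking walks apart.
  lipschitz⇒≤ : (φ : Fin n → ℕ) → (∀ {u v} → Adj G u v → φ u ≤ suc (φ v)) →
                ∀ {l u v} → Walk G l u v → φ u ≤ l + φ v
  lipschitz⇒≤ φ φ-lip []      = ℕ.≤-refl
  lipschitz⇒≤ φ φ-lip (e ∷ p) = ℕ.≤-trans (φ-lip e) (s≤s (lipschitz⇒≤ φ φ-lip p))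

  neighbour : ∀ {l u v} → Walk G l u v → u ≢ v → ∃ (Adj G u)
  neighbour []      u≢u = contradiction refl u≢u
  neighbour (e ∷ _) _   = _ , e

  distance-unique : ∀ {u v d d′} → IsDistance G u v d → IsDistance G u v d′ → d ≡ d′
  distance-unique (p , d≤) (p′ , d′≤) = ℕ.≤-antisym (d≤ _ p′) (d′≤ _ p)

  distance-sym : ∀ {u v d} → IsDistance G u v d → IsDistance G v u d
  distance-sym (p , d≤) = reverse p , λ l q → d≤ l (reverse q)

  distance-refl : ∀ {u d} → IsDistance G u u d → d ≡ 0
  distance-refl (_ , d≤) = ℕ.n≤0⇒n≡0 (d≤ 0 [])

  distance-lipschitz : ∀ {u v w d d′} → Adj G u v →
                       IsDistance G u w d → IsDistance G v w d′ → d ≤ suc d′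
  distance-lipschitz e (_ , d≤) (p , _) = d≤ _ (e ∷ p)

  degree>0 : ∀ {u v} → Adj G u v → 1 ≤ degree G u
  degree>0 {u} {v} e =
    subst (_≤ degree G u) (⟦⟧-true (adj? G u v) e) (term≤∑ (λ w → ⟦ adj? G u w ⟧) v)

-- Connected graphs and the path

Connected : ∀ {n} → Graph n → Set
Connected G = ∀ u v → ∃[ l ] Walk G l u v

-- With two vertices, `punchIn u zero` is one that differs from `u`, and a walk from `u` to it
-- starts with an edge at `u`.
connected-degree>0 : ∀ {n} {G : Graph n} → 2 ≤ n → Connected G → ∀ u → 1 ≤ degree G u
connected-degree>0 {G = G} (s≤s (s≤s z≤n)) conn u =
  degree>0 {G = G} (proj₂ (neighbour (proj₂ (conn u (punchIn u zero))) (punchInᵢ≢i u zero ∘ sym)))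

-- The counterpart of `distance` for a bare graph; it supplies the distances along the path.
connected-distance : ∀ {n} {G : Graph n} → Connected G → ∀ u v → ∃ (IsDistance G u v)
connected-distance {G = G} conn u v with conn u v
... | l , p = least (λ d → walk? G d u v) l p

path-suc : ∀ {m l} {i j : Fin m} → Walk (path m) l i j → Walk (path (suc m)) l (suc i) (suc j)
path-suc = mapWalk suc λ { (inj₁ e) → inj₁ (cong suc e) ; (inj₂ e) → inj₂ (cong suc e) }

path-from-zero : ∀ {m} (i : Fin (suc m)) → ∃[ l ] Walk (path (suc m)) l zero i
path-from-zero         zero    = 0 , []
path-from-zero {suc m} (suc i) with path-from-zero i
... | l , p = suc l , inj₁ refl ∷ path-suc p

path-connected : ∀ m → Connected (path m)
path-connected (suc m) i j with path-from-zero i | path-from-zero j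
... | _ , p | _ , q = _ , reverse p ++ q

-- The sum over ordered pairs, in which each unordered pair occurs twice

module _ {n} (T : Tree n) where

  private
    χ : Fin n → ℕ
    χ u = ⟦ pendent? (graph T) u ⟧

    f : Fin n → Fin n → ℕ
    f u v = ⟦ u <? v ×-dec pendent? (graph T) u ×-dec pendent? (graph T) v ⟧ * dist T u v

    dist-sym : ∀ u v → dist T u v ≡ dist T v u
    dist-sym u v =
      distance-unique (proj₂ (distance T u v)) (distance-sym (proj₂ (distance T v u)))

    f-⟦<⟧ : ∀ u v → f u v ≡ ⟦ u <? v ⟧ * (χ u * χ v * dist T u v)
    f-⟦<⟧ u v = begin
      f u v
        ≡⟨ cong (_* dist T u v) (⟦⟧-× (u <? v) (pendent? (graph T) u ×-dec pendent? (graph T) v)) ⟩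
      ⟦ u <? v ⟧ * ⟦ pendent? (graph T) u ×-dec pendent? (graph T) v ⟧ * dist T u v
        ≡⟨ cong (λ x → ⟦ u <? v ⟧ * x * dist T u v)
                (⟦⟧-× (pendent? (graph T) u) (pendent? (graph T) v)) ⟩
      ⟦ u <? v ⟧ * (χ u * χ v) * dist T u v
        ≡⟨ ℕ.*-assoc ⟦ u <? v ⟧ _ _ ⟩
      ⟦ u <? v ⟧ * (χ u * χ v * dist T u v) ∎
      where open ≡-Reasoning

    f-< : ∀ {u v} → u < v → f u v ≡ χ u * χ v * dist T u v
    f-< {u} {v} u<v =
      trans (f-⟦<⟧ u v)
            (trans (cong (_* (χ u * χ v * dist T u v)) (⟦⟧-true (u <? v) u<v)) (ℕ.*-identityˡ _))

    f-≮ : ∀ {u v} → ¬ u < v → f u v ≡ 0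
    f-≮ {u} {v} u≮v =
      trans (f-⟦<⟧ u v) (cong (_* (χ u * χ v * dist T u v)) (⟦⟧-false (u <? v) u≮v))

    f+f : ∀ u v → f u v + f v u ≡ χ u * χ v * dist T u v
    f+f u v with <-cmp u v
    ... | tri< u<v _ v≮u = trans (cong₂ _+_ (f-< u<v) (f-≮ v≮u)) (ℕ.+-identityʳ _)
    ... | tri> u≮v _ v<u =
      trans (cong₂ _+_ (f-≮ u≮v) (f-< v<u))
            (cong₂ _*_ (ℕ.*-comm (χ v) (χ u)) (dist-sym v u))
    ... | tri≈ u≮u refl _ =
      trans (cong₂ _+_ (f-≮ u≮u) (f-≮ u≮u))
            (sym (trans (cong (χ u * χ u *_) (distance-refl (proj₂ (distance T u u))))
                        (ℕ.*-zeroʳ (χ u * χ u))))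

  -- Exchanging the sums in one copy of `TW T` puts the terms at `(u , v)` and `(v , u)` together;
  -- off the diagonal exactly one of them has its indices in increasing order, and on it both sides
  -- are zero. This removes the condition `u < v`, which an isomorphism need not preserve.
  TW+TW : TW T + TW T ≡ ∑[ u < n ] ∑[ v < n ]
            (⟦ pendent? (graph T) u ⟧ * ⟦ pendent? (graph T) v ⟧ * dist T u v)
  TW+TW = begin
    TW T + TW T                             ≡⟨ cong (TW T +_) (∑-comm f) ⟩
    TW T + ∑[ u < n ] ∑[ v < n ] f v u      ≡⟨ ∑-distrib-+₂ f (λ u v → f v u) ⟨
    ∑[ u < n ] ∑[ v < n ] (f u v + f v u)   ≡⟨ ∑-cong₂ f+f ⟩
    _                                       ∎
    where open ≡-Reasoning

-- Invariance under isomorphism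

module _ {m n} (G : Graph m) (H : Graph n) (iso : G ≅ H) where

  private
    π = proj₁ iso

    π-adj = proj₂ iso

    π⁻ : ∀ {u v} → Adj H u v → Adj G (π ⟨$⟩ˡ u) (π ⟨$⟩ˡ v)
    π⁻ e = from (π-adj _ _) (subst₂ (Adj H) (sym (Perm.inverseʳ π)) (sym (Perm.inverseʳ π)) e)

  ≅-degree : ∀ u → degree G u ≡ degree H (π ⟨$⟩ʳ u)
  ≅-degree u = begin
    degree G u
      ≡⟨ sum-cong-≗ (λ v → ⟦⟧-cong (π-adj u v) (adj? G u v) (adj? H (π ⟨$⟩ʳ u) (π ⟨$⟩ʳ v))) ⟩
    ∑[ v < m ] ⟦ adj? H (π ⟨$⟩ʳ u) (π ⟨$⟩ʳ v) ⟧
      ≡⟨ sum-permute (λ w → ⟦ adj? H (π ⟨$⟩ʳ u) w ⟧) π ⟨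
    degree H (π ⟨$⟩ʳ u) ∎
    where open ≡-Reasoning

  ≅-pendent : ∀ u → ⟦ pendent? G u ⟧ ≡ ⟦ pendent? H (π ⟨$⟩ʳ u) ⟧
  ≅-pendent u = ⟦⟧-cong (mk⇔ (trans (sym (≅-degree u))) (trans (≅-degree u)))
                          (pendent? G u) (pendent? H (π ⟨$⟩ʳ u))

  ≅-distance : ∀ {u v d} → IsDistance H (π ⟨$⟩ʳ u) (π ⟨$⟩ʳ v) d → IsDistance G u v d
  ≅-distance (p , d≤) =
    subst₂ (Walk G _) (Perm.inverseˡ π) (Perm.inverseˡ π) (mapWalk (π ⟨$⟩ˡ_) π⁻ p) ,
    λ l q → d≤ l (mapWalk (π ⟨$⟩ʳ_) (to (π-adj _ _)) q)

-- Both sums are reindexed along the bijection. The distances of `H` enter as a function `δ`, so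
-- that an explicit formula can be used for them; uniqueness of distances identifies it with
-- `dist T`.
≅-TW : ∀ {m n} (T : Tree m) {H : Graph n} → graph T ≅ H →
       (δ : Fin n → Fin n → ℕ) → (∀ a b → IsDistance H a b (δ a b)) →
       TW T + TW T ≡ ∑[ a < n ] ∑[ b < n ] (⟦ pendent? H a ⟧ * ⟦ pendent? H b ⟧ * δ a b)
≅-TW {m} {n} T {H} iso@(π , _) δ δ-dist = begin
  TW T + TW T
    ≡⟨ TW+TW T ⟩
  ∑[ u < m ] ∑[ v < m ] (⟦ pendent? (graph T) u ⟧ * ⟦ pendent? (graph T) v ⟧ * dist T u v)
    ≡⟨ ∑-cong₂ (λ u v → cong₂ _*_
         (cong₂ _*_ (≅-pendent (graph T) H iso u) (≅-pendent (graph T) H iso v))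
         (distance-unique (proj₂ (distance T u v)) (≅-distance (graph T) H iso (δ-dist _ _)))) ⟩
  ∑[ u < m ] ∑[ v < m ] h (π ⟨$⟩ʳ u) (π ⟨$⟩ʳ v)
    ≡⟨ sum-cong-≗ (λ u → sum-permute (h (π ⟨$⟩ʳ u)) π) ⟨
  ∑[ u < m ] ∑[ b < n ] h (π ⟨$⟩ʳ u) b
    ≡⟨ sum-permute (λ a → ∑[ b < n ] h a b) π ⟨
  ∑[ a < n ] ∑[ b < n ] h a b ∎
  where
  open ≡-Reasoning
  h : Fin n → Fin n → ℕ
  h a b = ⟦ pendent? H a ⟧ * ⟦ pendent? H b ⟧ * δ a b

-- Attached graphs

-- These are the vertices of a copy that stay pendent after its root has been identified with a
-- vertex of the base; see `attach-pendent`.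
rootedPendent? : ∀ {n} ((G , r) : RootedGraph n) u → Dec (Pendent G u × u ≢ r)
rootedPendent? (G , r) u = pendent? G u ×-dec ¬? (u ≟ r)

∑-rootedPendent : ∀ {n} ((G , r) : RootedGraph n) →
  ∑[ u < n ] ⟦ rootedPendent? (G , r) u ⟧ ≡ #pendent G ∸ ⟦ pendent? G r ⟧
∑-rootedPendent {n} (G , r) = begin
  q
    -- The term of the root is added and subtracted again; the added one completes the count to all
    -- pendent vertices.
    ≡⟨ ℕ.m+n∸n≡m q χᵣ ⟨
  q + χᵣ ∸ χᵣ
    ≡⟨ cong (λ x → q + x ∸ χᵣ) (∑-⟦≟⟧ r (λ u → ⟦ pendent? G u ⟧)) ⟨
  q + ∑[ u < n ] (⟦ r ≟ u ⟧ * ⟦ pendent? G u ⟧) ∸ χᵣ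
    ≡⟨ cong (_∸ χᵣ) (∑-distrib-+ (λ u → ⟦ rootedPendent? (G , r) u ⟧) _) ⟨
  ∑[ u < n ] (⟦ rootedPendent? (G , r) u ⟧ + ⟦ r ≟ u ⟧ * ⟦ pendent? G u ⟧) ∸ χᵣ
    ≡⟨ cong (_∸ χᵣ) (sum-cong-≗ split) ⟩
  #pendent G ∸ χᵣ ∎
  where
  open ≡-Reasoning
  q  = ∑[ u < n ] ⟦ rootedPendent? (G , r) u ⟧
  χᵣ = ⟦ pendent? G r ⟧

  split : ∀ u → ⟦ rootedPendent? (G , r) u ⟧ + ⟦ r ≟ u ⟧ * ⟦ pendent? G u ⟧ ≡ ⟦ pendent? G u ⟧
  split u with r ≟ u
  ... | yes refl =
    trans (cong (_+ 1 * χᵣ) (⟦⟧-false (rootedPendent? (G , r) r) (λ (_ , r≢r) → r≢r refl)))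
          (ℕ.*-identityˡ χᵣ)
  ... | no r≢u   =
    trans (ℕ.+-identityʳ _)
          (⟦⟧-cong (mk⇔ proj₁ (_, r≢u ∘ sym)) (rootedPendent? (G , r) u) (pendent? G u))

-- `remQuot` unfolds to `quotRem` followed by a swap, so rewriting in the adjacency of an attached
-- graph calls for this form.
quotRem-combine : ∀ {m n} (i : Fin m) (u : Fin n) → quotRem n (combine i u) ≡ (u , i)
quotRem-combine i u = cong swap (remQuot-combine i u)

module _ {n} (R : RootedGraph n) (d : Fin n → Fin n → ℕ) where

  private
    r : Fin n
    r = proj₂ R

    χ : Fin n → ℕ
    χ u = ⟦ rootedPendent? R u ⟧

  -- `withinSum` runs over ordered pairs, so each unordered pair counts twice. As `d` is an
  -- arbitrary function, the sums towards and from the root are separate; for a distance they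
  -- coincide.
  withinSum toRootSum fromRootSum : ℕ
  withinSum   = ∑[ u < n ] ∑[ v < n ] (χ u * χ v * d u v)
  toRootSum   = ∑[ u < n ] (χ u * d u r)
  fromRootSum = ∑[ v < n ] (χ v * d r v)

module _ {m n : ℕ} (T : Graph m) (F : Fin m → RootedGraph n) where

  private
    G : Fin m → Graph n
    G i = proj₁ (F i)

    r : Fin m → Fin n
    r i = proj₂ (F i)

    H : Graph (m * n)
    H = attach T F

  -- Adjacency and degrees in an attached graph

  attach-copy : ∀ i {u v} → Adj (G i) u v → Adj H (combine i u) (combine i v)
  attach-copy i {u} {v} e rewrite quotRem-combine i u | quotRem-combine i v = inj₁ (refl , e)

  attach-base : ∀ {i j} → Adj T i j → Adj H (combine i (r i)) (combine j (r j))
  attach-base {i} {j} e rewrite quotRem-combine i (r i) | quotRem-combine j (r j) =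
    inj₂ (e , refl , refl)

  -- An edge inside a copy and an edge of `T` exclude each other because `T` has no loops, so their
  -- brackets add. The last bracket is turned to `r j ≟ v` to let `∑-⟦≟⟧` collapse a sum over `v`.
  ⟦attach⟧ : ∀ i u j v → ⟦ adj? H (combine i u) (combine j v) ⟧ ≡
             ⟦ i ≟ j ⟧ * ⟦ adj? (G i) u v ⟧ + ⟦ adj? T i j ⟧ * (⟦ u ≟ r i ⟧ * ⟦ r j ≟ v ⟧)
  ⟦attach⟧ i u j v rewrite quotRem-combine i u | quotRem-combine j v = begin
    _
      ≡⟨ ⟦⟧-⊎ (i ≟ j ×-dec adj? (G i) u v) (adj? T i j ×-dec u ≟ r i ×-dec v ≟ r j)
              (λ { ((refl , _) , (e , _)) → irrefl T refl e }) ⟩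
    ⟦ i ≟ j ×-dec adj? (G i) u v ⟧ + ⟦ adj? T i j ×-dec u ≟ r i ×-dec v ≟ r j ⟧
      ≡⟨ cong₂ _+_ (⟦⟧-× (i ≟ j) (adj? (G i) u v))
           (trans (⟦⟧-× (adj? T i j) (u ≟ r i ×-dec v ≟ r j))
             (cong (⟦ adj? T i j ⟧ *_) (trans (⟦⟧-× (u ≟ r i) (v ≟ r j))
               (cong (⟦ u ≟ r i ⟧ *_) (⟦⟧-cong (mk⇔ sym sym) (v ≟ r j) (r j ≟ v)))))) ⟩
    _ ∎
    where open ≡-Reasoning

  attach-degree : ∀ i u → degree H (combine i u) ≡ degree (G i) u + ⟦ u ≟ r i ⟧ * degree T i
  attach-degree i u = begin
    degree H (combine i u)
      ≡⟨ ∑-combine m (λ b → ⟦ adj? H (combine i u) b ⟧) ⟩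
    ∑[ j < m ] ∑[ v < n ] ⟦ adj? H (combine i u) (combine j v) ⟧
      ≡⟨ ∑-cong₂ (⟦attach⟧ i u) ⟩
    ∑[ j < m ] ∑[ v < n ] (inner j v + outer j v)
      ≡⟨ ∑-distrib-+₂ inner outer ⟩
    ∑[ j < m ] ∑[ v < n ] inner j v + ∑[ j < m ] ∑[ v < n ] outer j v
      ≡⟨ cong₂ _+_ ∑-inner ∑-outer ⟩
    degree (G i) u + ⟦ u ≟ r i ⟧ * degree T i ∎
    where
    open ≡-Reasoning
    inner outer : Fin m → Fin n → ℕ
    inner j v = ⟦ i ≟ j ⟧ * ⟦ adj? (G i) u v ⟧
    outer j v = ⟦ adj? T i j ⟧ * (⟦ u ≟ r i ⟧ * ⟦ r j ≟ v ⟧)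

    ∑-inner : ∑[ j < m ] ∑[ v < n ] inner j v ≡ degree (G i) u
    ∑-inner = trans (sum-cong-≗ λ j → sym (*-distribˡ-sum ⟦ i ≟ j ⟧ (λ v → ⟦ adj? (G i) u v ⟧)))
                    (∑-⟦≟⟧ i (λ _ → degree (G i) u))

    rearrange : ∀ a b c → a * (b * c) ≡ c * (b * a)
    rearrange = solve-∀

    ∑-outer : ∑[ j < m ] ∑[ v < n ] outer j v ≡ ⟦ u ≟ r i ⟧ * degree T i
    ∑-outer = begin
      ∑[ j < m ] ∑[ v < n ] outer j v
        ≡⟨ ∑-cong₂ (λ j v → rearrange ⟦ adj? T i j ⟧ ⟦ u ≟ r i ⟧ ⟦ r j ≟ v ⟧) ⟩
      ∑[ j < m ] ∑[ v < n ] (⟦ r j ≟ v ⟧ * (⟦ u ≟ r i ⟧ * ⟦ adj? T i j ⟧))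
        ≡⟨ sum-cong-≗ (λ j → ∑-⟦≟⟧ (r j) (λ _ → ⟦ u ≟ r i ⟧ * ⟦ adj? T i j ⟧)) ⟩
      ∑[ j < m ] (⟦ u ≟ r i ⟧ * ⟦ adj? T i j ⟧)
        ≡⟨ *-distribˡ-sum ⟦ u ≟ r i ⟧ (λ j → ⟦ adj? T i j ⟧) ⟨
      ⟦ u ≟ r i ⟧ * degree T i ∎

  -- Away from the root the degree is that in the copy. At the root the two positivity hypotheses
  -- add up to a degree of at least 2.
  attach-pendent : (∀ i → 1 ≤ degree T i) → (∀ i → 1 ≤ degree (G i) (r i)) → ∀ i u →
                   ⟦ pendent? H (combine i u) ⟧ ≡ ⟦ rootedPendent? (F i) u ⟧
  attach-pendent T>0 r>0 i u =
    ⟦⟧-cong (mk⇔ (λ p → pendent p (u ≟ r i)) (λ (p , u≢r) → trans (deg≡ u≢r) p))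
            (pendent? H (combine i u)) (rootedPendent? (F i) u)
    where
    deg≡ : u ≢ r i → degree H (combine i u) ≡ degree (G i) u
    deg≡ u≢r = begin
      degree H (combine i u)
        ≡⟨ attach-degree i u ⟩
      degree (G i) u + ⟦ u ≟ r i ⟧ * degree T i
        ≡⟨ cong (λ x → degree (G i) u + x * degree T i) (⟦⟧-false (u ≟ r i) u≢r) ⟩
      degree (G i) u + 0
        ≡⟨ ℕ.+-identityʳ _ ⟩
      degree (G i) u ∎
      where open ≡-Reasoning

    deg-root>1 : 2 ≤ degree H (combine i (r i))
    deg-root>1 = begin
      2
        ≤⟨ ℕ.+-mono-≤ (r>0 i) (T>0 i) ⟩
      degree (G i) (r i) + degree T i
        ≡⟨ cong (degree (G i) (r i) +_) (ℕ.*-identityˡ _) ⟨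
      degree (G i) (r i) + 1 * degree T i
        ≡⟨ cong (λ x → degree (G i) (r i) + x * degree T i) (⟦⟧-true (r i ≟ r i) refl) ⟨
      degree (G i) (r i) + ⟦ r i ≟ r i ⟧ * degree T i
        ≡⟨ attach-degree i (r i) ⟨
      degree H (combine i (r i)) ∎
      where open ℕ.≤-Reasoning

    pendent : Pendent H (combine i u) → Dec (u ≡ r i) → Pendent (G i) u × u ≢ r i
    pendent p (yes u≡r) =
      contradiction (subst (λ v → Pendent H (combine i v)) u≡r p) (ℕ.>⇒≢ deg-root>1)
    pendent p (no u≢r)  = trans (sym (deg≡ u≢r)) p , u≢r

  -- Distances in an attached graph

  module AttachDistance
    (dT : Fin m → Fin m → ℕ) (dT-dist : ∀ i j → IsDistance T i j (dT i j))
    (d : Fin m → Fin n → Fin n → ℕ) (d-dist : ∀ i u v → IsDistance (G i) u v (d i u v))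
    where

    -- Between distinct copies the route leads to the first root, along `T`, and on from the second
    -- root. Inside one copy the detour through the root could be too long, hence the case
    -- distinction.
    δ : Fin m × Fin n → Fin m × Fin n → ℕ
    δ (i , u) (j , v) =
      if does (i ≟ j) then d i u v else d i u (r i) + dT i j + d j (r j) v

    δ-same : ∀ i u v → δ (i , u) (i , v) ≡ d i u v
    δ-same i u v rewrite dec-true (i ≟ i) refl = refl

    δ-diff : ∀ {i j} → i ≢ j → ∀ u v →
             δ (i , u) (j , v) ≡ d i u (r i) + dT i j + d j (r j) v
    δ-diff {i} {j} i≢j u v rewrite dec-false (i ≟ j) i≢j = refl

    δ-root : ∀ i j v → δ (i , r i) (j , v) ≡ dT i j + d j (r j) v
    δ-root i j v with i ≟ j
    ... | yes refl = cong (_+ d i (r i) v) (sym (distance-refl (dT-dist i i)))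
    ... | no  i≢j  = cong (λ x → x + dT i j + d j (r j) v) (distance-refl (d-dist i (r i) (r i)))

    private
      δ-copy : ∀ i {u u′} c → Adj (G i) u u′ → δ (i , u) c ≤ suc (δ (i , u′) c)
      δ-copy i (j , v) e with i ≟ j
      ... | yes refl = distance-lipschitz e (d-dist i _ v) (d-dist i _ v)
      ... | no  _    = ℕ.+-monoˡ-≤ _ (ℕ.+-monoˡ-≤ (dT i j)
                         (distance-lipschitz e (d-dist i _ (r i)) (d-dist i _ (r i))))

      δ-base : ∀ {i i′} c → Adj T i i′ → δ (i , r i) c ≤ suc (δ (i′ , r i′) c)
      δ-base {i} {i′} (j , v) e = subst₂ (λ x y → x ≤ suc y) (sym (δ-root i j v)) (sym (δ-root i′ j v))
        (ℕ.+-monoˡ-≤ _ (distance-lipschitz e (dT-dist i j) (dT-dist i′ j)))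

      δ-lipschitz : ∀ c {a b} → Adj H a b → δ (remQuot n a) c ≤ suc (δ (remQuot n b) c)
      δ-lipschitz c {a} {b} e with quotRem {m} n a | quotRem {m} n b | e
      ... | _ , i | _ | inj₁ (refl , e′)        = δ-copy i c e′
      ... | _     | _ | inj₂ (e′ , refl , refl) = δ-base c e′

      δ-walk : ∀ i u j v → Walk H (δ (i , u) (j , v)) (combine i u) (combine j v)
      δ-walk i u j v with i ≟ j
      ... | yes refl = mapWalk (combine i) (attach-copy i) (proj₁ (d-dist i u v))
      ... | no  _    =
        (mapWalk (combine i) (attach-copy i) (proj₁ (d-dist i u (r i)))
          ++ mapWalk (λ l → combine l (r l)) attach-base (proj₁ (dT-dist i j)))
          ++ mapWalk (combine j) (attach-copy j) (proj₁ (d-dist j (r j) v))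

    -- The concatenated walk attains `δ`. No walk is shorter, because `δ` to a fixed target drops by
    -- at most one along every edge and vanishes at the target.
    attach-distance : ∀ a b → IsDistance H a b (δ (remQuot n a) (remQuot n b))
    attach-distance a b =
      subst₂ (Walk H _) (combine-remQuot {m} n a) (combine-remQuot {m} n b) (δ-walk _ _ _ _) ,
      λ l p → subst (δ (remQuot n a) (remQuot n b) ≤_)
        (trans (cong (l +_) δ-refl) (ℕ.+-identityʳ l))
        (lipschitz⇒≤ (λ a′ → δ (remQuot n a′) (remQuot n b)) (δ-lipschitz (remQuot n b)) p)
      where
      δ-refl : δ (remQuot n b) (remQuot n b) ≡ 0
      δ-refl = trans (δ-same _ _ _) (distance-refl (d-dist _ _ _))

    -- Sums over pairs of copies

    module _ (p : ℕ) (∑≡p : ∀ i → ∑[ u < n ] ⟦ rootedPendent? (F i) u ⟧ ≡ p) where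

      private
        χ : Fin m → Fin n → ℕ
        χ i u = ⟦ rootedPendent? (F i) u ⟧

        W D D′ : Fin m → ℕ
        W  i = withinSum (F i) (d i)
        D  i = toRootSum (F i) (d i)
        D′ i = fromRootSum (F i) (d i)

      pairSum : Fin m → Fin m → ℕ
      pairSum i j = ∑[ u < n ] ∑[ v < n ] (χ i u * χ j v * δ (i , u) (j , v))

      pairSum-same : ∀ i → pairSum i i ≡ W i
      pairSum-same i = ∑-cong₂ λ u v → cong (χ i u * χ i v *_) (δ-same i u v)

      -- Each leg of the route depends on at most one of `u` and `v`, so the three double sums
      -- factor by `∑-*`, and every sum of brackets alone is `p`.
      pairSum-diff : ∀ {i j} → i ≢ j → pairSum i j ≡ p * D i + p * p * dT i j + p * D′ j
      pairSum-diff {i} {j} i≢j = begin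
        pairSum i j
          ≡⟨ ∑-cong₂ (λ u v → trans (cong (χ i u * χ j v *_) (δ-diff i≢j u v))
               (expand (χ i u) (χ j v) (d i u (r i)) (dT i j) (d j (r j) v))) ⟩
        ∑[ u < n ] ∑[ v < n ] (a u * χ j v + b u * χ j v + χ i u * c v)
          ≡⟨ ∑-distrib-+₂ (λ u v → a u * χ j v + b u * χ j v) (λ u v → χ i u * c v) ⟩
        ∑[ u < n ] ∑[ v < n ] (a u * χ j v + b u * χ j v) + ∑[ u < n ] ∑[ v < n ] (χ i u * c v)
          ≡⟨ cong (_+ ∑[ u < n ] ∑[ v < n ] (χ i u * c v))
                  (∑-distrib-+₂ (λ u v → a u * χ j v) (λ u v → b u * χ j v)) ⟩
        ∑[ u < n ] ∑[ v < n ] (a u * χ j v) + ∑[ u < n ] ∑[ v < n ] (b u * χ j v)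
          + ∑[ u < n ] ∑[ v < n ] (χ i u * c v)
          ≡⟨ cong₂ _+_ (cong₂ _+_ (∑-* a (χ j)) (∑-* b (χ j))) (∑-* (χ i) c) ⟩
        D i * ∑χ j + ∑[ u < n ] b u * ∑χ j + ∑χ i * D′ j
          ≡⟨ cong (λ x → D i * ∑χ j + x * ∑χ j + ∑χ i * D′ j) (*-distribʳ-sum (dT i j) (χ i)) ⟨
        D i * ∑χ j + ∑χ i * dT i j * ∑χ j + ∑χ i * D′ j
          ≡⟨ cong₂ (λ x y → D i * y + x * dT i j * y + x * D′ j) (∑≡p i) (∑≡p j) ⟩
        D i * p + p * dT i j * p + p * D′ j
          ≡⟨ collect p (D i) (dT i j) (D′ j) ⟩
        p * D i + p * p * dT i j + p * D′ j ∎
        where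
        open ≡-Reasoning
        a b c : Fin n → ℕ
        a u = χ i u * d i u (r i)
        b u = χ i u * dT i j
        c v = χ j v * d j (r j) v

        ∑χ : Fin m → ℕ
        ∑χ l = ∑[ u < n ] χ l u

        expand : ∀ x y k l o → x * y * (k + l + o) ≡ (x * k) * y + (x * l) * y + x * (y * o)
        expand = solve-∀

        collect : ∀ x k l o → k * x + x * l * x + x * o ≡ x * k + x * x * l + x * o
        collect = solve-∀

      -- The diagonal is corrected on the left, so that no subtraction occurs.
      pairSum-uniform : ∀ i j → pairSum i j + ⟦ i ≟ j ⟧ * (p * (D j + D′ j)) ≡
                        ⟦ i ≟ j ⟧ * W j + (p * D i + p * p * dT i j + p * D′ j)
      pairSum-uniform i j = by-cases (i ≟ j)
        where
        -- The 0 is the distance in `T` from a vertex to itself.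
        diagonal : ∀ w x k l → w + 1 * (x * (k + l)) ≡ 1 * w + (x * k + x * x * 0 + x * l)
        diagonal = solve-∀

        Goal : ℕ → ℕ → Set
        Goal x b = x + b * (p * (D j + D′ j)) ≡ b * W j + (p * D i + p * p * dT i j + p * D′ j)

        by-cases : Dec (i ≡ j) → Goal (pairSum i j) ⟦ i ≟ j ⟧
        by-cases (yes refl) =
          subst₂ Goal (sym (pairSum-same i)) (sym (⟦⟧-true (i ≟ i) refl))
            (subst (λ x → W i + 1 * (p * (D i + D′ i)) ≡ 1 * W i + (p * D i + p * p * x + p * D′ i))
                   (sym (distance-refl (dT-dist i i))) (diagonal (W i) p (D i) (D′ i)))
        by-cases (no i≢j) =
          subst₂ Goal (sym (pairSum-diff i≢j)) (sym (⟦⟧-false (i ≟ j) i≢j)) (ℕ.+-identityʳ _)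

      -- Summing `pairSum-uniform` over all `i` and `j`, each bracket leaves only the diagonal term.
      -- Every sum on the right now has a term that involves at most one copy.
      ∑-pairSum : ∑[ i < m ] ∑[ j < m ] pairSum i j + ∑[ i < m ] (p * (D i + D′ i)) ≡
                  ∑[ i < m ] W i + (∑[ i < m ] ∑[ j < m ] (p * D i)
                    + ∑[ i < m ] ∑[ j < m ] (p * p * dT i j) + ∑[ i < m ] ∑[ j < m ] (p * D′ j))
      ∑-pairSum = begin
        ∑[ i < m ] ∑[ j < m ] pairSum i j + ∑[ i < m ] (p * (D i + D′ i))
          ≡⟨ cong (∑[ i < m ] ∑[ j < m ] pairSum i j +_)
                  (sum-cong-≗ (λ i → ∑-⟦≟⟧ i (λ j → p * (D j + D′ j)))) ⟨
        ∑[ i < m ] ∑[ j < m ] pairSum i j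
          + ∑[ i < m ] ∑[ j < m ] (⟦ i ≟ j ⟧ * (p * (D j + D′ j)))
          ≡⟨ ∑-distrib-+₂ pairSum (λ i j → ⟦ i ≟ j ⟧ * (p * (D j + D′ j))) ⟨
        ∑[ i < m ] ∑[ j < m ] (pairSum i j + ⟦ i ≟ j ⟧ * (p * (D j + D′ j)))
          ≡⟨ ∑-cong₂ pairSum-uniform ⟩
        ∑[ i < m ] ∑[ j < m ] (⟦ i ≟ j ⟧ * W j + (p * D i + p * p * dT i j + p * D′ j))
          ≡⟨ ∑-distrib-+₂ (λ i j → ⟦ i ≟ j ⟧ * W j)
                          (λ i j → p * D i + p * p * dT i j + p * D′ j) ⟩
        ∑[ i < m ] ∑[ j < m ] (⟦ i ≟ j ⟧ * W j)
          + ∑[ i < m ] ∑[ j < m ] (p * D i + p * p * dT i j + p * D′ j)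
          ≡⟨ cong₂ _+_ (sum-cong-≗ (λ i → ∑-⟦≟⟧ i W))
               (trans (∑-distrib-+₂ (λ i j → p * D i + p * p * dT i j) (λ i j → p * D′ j))
                 (cong (_+ ∑[ i < m ] ∑[ j < m ] (p * D′ j))
                       (∑-distrib-+₂ (λ i j → p * D i) (λ i j → p * p * dT i j)))) ⟩
        _ ∎
        where open ≡-Reasoning

      -- Each vertex is split into its copy and its position there; exchanging the two middle sums
      -- groups the ordered pairs by their copies.
      attach-TW : (∀ i → 1 ≤ degree T i) → (∀ i → 1 ≤ degree (G i) (r i)) →
                  ∀ {N} (Z : Tree N) → graph Z ≅ H →
                  TW Z + TW Z ≡ ∑[ i < m ] ∑[ j < m ] pairSum i j
      attach-TW T>0 r>0 Z iso = begin
        TW Z + TW Z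
          ≡⟨ ≅-TW Z iso (λ a b → δ (remQuot n a) (remQuot n b)) attach-distance ⟩
        ∑[ a < m * n ] ∑[ b < m * n ] h a b
          ≡⟨ ∑-combine m (λ a → ∑[ b < m * n ] h a b) ⟩
        ∑[ i < m ] ∑[ u < n ] ∑[ b < m * n ] h (combine i u) b
          ≡⟨ ∑-cong₂ {m} {n} (λ i u → ∑-combine m (h (combine i u))) ⟩
        ∑[ i < m ] ∑[ u < n ] ∑[ j < m ] ∑[ v < n ] h′ i u j v
          ≡⟨ sum-cong-≗ (λ i → ∑-comm (λ u j → ∑[ v < n ] h′ i u j v)) ⟩
        ∑[ i < m ] ∑[ j < m ] ∑[ u < n ] ∑[ v < n ] h′ i u j v
          ≡⟨ ∑-cong₂ {m} {m} (λ i j → ∑-cong₂ {n} {n} (λ u v →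
               cong₂ _*_ (cong₂ _*_ (attach-pendent T>0 r>0 i u) (attach-pendent T>0 r>0 j v))
                         (cong₂ δ (remQuot-combine i u) (remQuot-combine j v)))) ⟩
        ∑[ i < m ] ∑[ j < m ] pairSum i j ∎
        where
        open ≡-Reasoning
        h : Fin (m * n) → Fin (m * n) → ℕ
        h a b = ⟦ pendent? H a ⟧ * ⟦ pendent? H b ⟧ * δ (remQuot n a) (remQuot n b)

        h′ : Fin m → Fin n → Fin m → Fin n → ℕ
        h′ i u j v = h (combine i u) (combine j v)

-- Comparing two members of `STW`

≇⇒2≤n : ∀ {n} (G H : Graph n) → Fin n → ¬ (G ≅ H) → 2 ≤ n
≇⇒2≤n {suc (suc n)} G H _ _   = s≤s (s≤s z≤n)
-- On a single vertex both adjacency relations are empty, so the identity is an isomorphism.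
≇⇒2≤n {suc zero}    G H _ G≇H =
  contradiction (Perm.id , λ { zero zero → mk⇔ (λ e → contradiction e (irrefl G refl))
                                              (λ e → contradiction e (irrefl H refl)) }) G≇H

theorem3p1 : ∀ (k : ℕ) → 1 ≤ k →
    ∀ {n : ℕ} (X Y : Tree n) → ¬ (graph X ≅ graph Y) →
    ∀ (s t : Fin n) →
    #pendent (graph X) ∸ ⟦ pendent? (graph X) s ⟧ ≡ #pendent (graph Y) ∸ ⟦ pendent? (graph Y) t ⟧ →
    ∀ {N N′ : ℕ} (Z : Tree N) (Z′ : Tree N′) →
    STW k (path (2 * k)) (graph X , s) (graph Y , t) Z →
    STW k (path (2 * k)) (graph X , s) (graph Y , t) Z′ →
    TW Z ≡ TW Z′
theorem3p1 k 1≤k {n} X Y X≇Y s t pX≡pY Z Z′ Z∈ Z′∈ =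
  -- The right-hand side of `formula` is the same for `Z` and `Z′`; the common correction term
  -- cancels, and then the factor 2.
  ℕ.*-cancelˡ-≡ (TW Z) (TW Z′) 2
    (subst₂ _≡_ (double (TW Z)) (double (TW Z′))
      (ℕ.+-cancelʳ-≡ _ _ _ (trans (formula Z Z∈) (sym (formula Z′ Z′∈)))))
  where
  double : ∀ x → x + x ≡ 2 * x
  double = solve-∀

  m p : ℕ
  m = 2 * k
  p = #pendent (graph X) ∸ ⟦ pendent? (graph X) s ⟧

  2≤n : 2 ≤ n
  2≤n = ≇⇒2≤n (graph X) (graph Y) s X≇Y

  path-distance : ∀ i j → ∃ (IsDistance (path m) i j)
  path-distance = connected-distance (path-connected m)

  dP : Fin m → Fin m → ℕ
  dP i j = proj₁ (path-distance i j)

  -- With this form `R ∘ lookup A` is by definition the family attached in `STW`.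
  R : Bool → RootedGraph n
  R b = if b then (graph X , s) else (graph Y , t)

  dR : Bool → Fin n → Fin n → ℕ
  dR b = if b then dist X else dist Y

  dR-dist : ∀ b u v → IsDistance (proj₁ (R b)) u v (dR b u v)
  dR-dist true  u v = proj₂ (distance X u v)
  dR-dist false u v = proj₂ (distance Y u v)

  R>0 : ∀ b → 1 ≤ degree (proj₁ (R b)) (proj₂ (R b))
  R>0 true  = connected-degree>0 2≤n (Tree.connected X) s
  R>0 false = connected-degree>0 2≤n (Tree.connected Y) t

  R-pendent : ∀ b → ∑[ u < n ] ⟦ rootedPendent? (R b) u ⟧ ≡ p
  R-pendent true  = ∑-rootedPendent (R true)
  R-pendent false = trans (∑-rootedPendent (R false)) (sym pX≡pY)

  W D D′ : Bool → ℕ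
  W  b = withinSum (R b) (dR b)
  D  b = toRootSum (R b) (dR b)
  D′ b = fromRootSum (R b) (dR b)

  -- `m ∸ k` is the size of the complement of `A`, the number of copies of `Y`.
  total : (Bool → ℕ) → ℕ
  total g = k * g true + (m ∸ k) * g false

  ∑-total : ∀ (A : Subset m) → ∣ A ∣ ≡ k → ∀ g → ∑[ i < m ] g (lookup A i) ≡ total g
  ∑-total A ∣A∣≡k g = trans (∑-lookup A g)
    (cong₂ (λ x y → x * g true + y * g false) ∣A∣≡k
           (trans (∣∁p∣≡n∸∣p∣ A) (cong (m ∸_) ∣A∣≡k)))

  -- The set `A` enters only through `Z`: all sums over copies have become totals. The extra term on
  -- the left is the diagonal correction.
  formula : ∀ {N} (Z : Tree N) → STW k (path m) (graph X , s) (graph Y , t) Z →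
            TW Z + TW Z + total (λ b → p * (D b + D′ b)) ≡
            total W + (total (λ b → ∑[ j < m ] (p * D b))
              + ∑[ i < m ] ∑[ j < m ] (p * p * dP i j) + ∑[ i < m ] total (λ b → p * D′ b))
  formula Z (A , ∣A∣≡k , iso) = begin
    TW Z + TW Z + total (λ b → p * (D b + D′ b))
      ≡⟨ cong₂ _+_ (attach-TW p (R-pendent ∘ lookup A) path>0 (R>0 ∘ lookup A) Z iso)
                   (sym (∑A (λ b → p * (D b + D′ b)))) ⟩
    _ ≡⟨ ∑-pairSum p (R-pendent ∘ lookup A) ⟩
    _ ≡⟨ cong₂ _+_ (∑A W)
           (cong₂ _+_
             (cong (_+ ∑[ i < m ] ∑[ j < m ] (p * p * dP i j)) (∑A (λ b → ∑[ j < m ] (p * D b))))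
             (sum-cong-≗ {m} (λ _ → ∑A (λ b → p * D′ b)))) ⟩
    _ ∎
    where
    open ≡-Reasoning
    open AttachDistance (path m) (R ∘ lookup A) dP (λ i j → proj₂ (path-distance i j))
                        (dR ∘ lookup A) (dR-dist ∘ lookup A)

    ∑A : ∀ g → ∑[ i < m ] g (lookup A i) ≡ total g
    ∑A = ∑-total A ∣A∣≡k

    path>0 : ∀ i → 1 ≤ degree (path m) i
    -- Since `k` is at least 1, the path has at least two vertices.
    path>0 = connected-degree>0 (ℕ.*-monoʳ-≤ 2 1≤k) (path-connected m)
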